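{- There is a closed graph $G$ on the Cantor space $2^\omega$ without isolated vertices (in the sense of graph theory) such that $G$ contains a dense induced copy of the random graph $\mathbf R$, i.e. there is a dense subset of $2^\omega$ which, as an induced subgraph of $G$, is isomorphic to $\mathbf R$. In particular, every countable graph embeds into a closed graph on $2^\omega$.
   Context: A graph is a pair $(V,E)$ where $E$ is a symmetric and reflexive binary relation on $V$ (every vertex has a loop). A closed graph on a topological space $X$ is a graph with vertex set $X$ whose edge relation is a closed subset of $X\times X$. A vertex is isolated (in the graph-theoretic sense) if it is adjacent only to itself. An embedding of graphs is an isomorphism onto an induced subgraph. $\mathbf R$ is the random graph: the unique (up to isomorphism) countable graph such that for all disjoint finite $A,B\subseteq\mathbf R$ there is a vertex in $\mathbf R\setminus(A\cup B)$ adjacent to all elements of $A$ and to no element of $B$. -}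

module Defs where

open import Data.Bool.Base using (Bool)
open import Data.List.Base using (List)
open import Data.List.Relation.Unary.All using (All)
import Data.List.Membership.Setoid as Membership
import Data.List.Relation.Binary.Disjoint.Setoid as Disjointness
open import Data.Nat.Base using (ℕ; _<_)
open import Data.Product.Base using (Σ; Σ-syntax; ∃-syntax; _×_; _,_; proj₁; proj₂)
open import Function.Base using (_on_)
open import Function.Bundles using (Injection; Inverse; _⇔_)
open import Level using (0ℓ; suc)
open import Relation.Binary.Bundles using (Setoid)
open import Relation.Binary.Core using (Rel)
open import Relation.Binary.Definitions using (Reflexive; Symmetric; _Respects₂_)
import Relation.Binary.Construct.On as On
open import Relation.Binary.PropositionalEquality using (_≡_; _→-setoid_; setoid)
open import Relation.Nullary.Negation using (¬_)
open import Relation.Unary using (Pred)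

-- Vertex sets are setoids: points of the Cantor space are functions, and
-- equality of vertices there has to be pointwise equality.  All graphs are
-- reflexive, i.e. every vertex carries a loop.
record Graph (V : Setoid 0ℓ 0ℓ) : Set (suc 0ℓ) where
  open Setoid V using (Carrier; _≈_)
  infix 4 _~_
  field
    _~_    : Rel Carrier 0ℓ
    ~-resp : _~_ Respects₂ _≈_
    ~-refl : Reflexive _~_
    ~-sym  : Symmetric _~_

module _ {V : Setoid 0ℓ 0ℓ} (G : Graph V) where
  open Setoid V using (Carrier; _≈_)
  open Graph G

  Isolated : Carrier → Set
  Isolated x = ∀ y → x ~ y → x ≈ y

  WithoutIsolatedVertices : Set
  WithoutIsolatedVertices = ∀ x → ¬ Isolated x

-- Membership proofs are ignored by the equality of the subset.
subset : (V : Setoid 0ℓ 0ℓ) → Pred (Setoid.Carrier V) 0ℓ → Setoid 0ℓ 0ℓ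
subset V D = On.setoid {B = Σ (Setoid.Carrier V) D} V proj₁

induced : {V : Setoid 0ℓ 0ℓ} → Graph V →
          (D : Pred (Setoid.Carrier V) 0ℓ) → Graph (subset V D)
induced G D = record
  { _~_    = _~_ on proj₁
  ; ~-resp = (λ e → proj₁ ~-resp e) , (λ e → proj₂ ~-resp e)
  ; ~-refl = ~-refl
  ; ~-sym  = ~-sym
  }
  where open Graph G

infix 4 _≅_
record _≅_ {V W : Setoid 0ℓ 0ℓ} (G : Graph V) (H : Graph W) : Set where
  field
    bijection : Inverse V W
  open Inverse bijection public using (to)
  field
    adjacency : ∀ x y → Graph._~_ G x y ⇔ Graph._~_ H (to x) (to y)

EmbedsInto : {V W : Setoid 0ℓ 0ℓ} → Graph V → Graph W → Set (suc 0ℓ)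
EmbedsInto {W = W} H G = Σ[ D ∈ Pred (Setoid.Carrier W) 0ℓ ] H ≅ induced G D

-- Finite sets are countable in this sense.
Countable : Setoid 0ℓ 0ℓ → Set
Countable V = Injection V (setoid ℕ)

-- Finite sets of vertices are given by lists.
ExtensionProperty : {V : Setoid 0ℓ 0ℓ} → Graph V → Set
ExtensionProperty {V} G =
  ∀ (A B : List Carrier) → Disjoint A B →
  ∃[ v ] v ∉ A × v ∉ B × All (λ a → v ~ a) A × All (λ b → ¬ (v ~ b)) B
  where
  open Setoid V using (Carrier)
  open Graph G
  open Membership V using (_∉_)
  open Disjointness V using (Disjoint)

-- Up to isomorphism there is exactly one graph with this property.
IsRandomGraph : {V : Setoid 0ℓ 0ℓ} → Graph V → Set
IsRandomGraph {V} R = Countable V × ExtensionProperty R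

Cantor : Setoid 0ℓ 0ℓ
Cantor = ℕ →-setoid Bool

2^ω : Set
2^ω = Setoid.Carrier Cantor

-- x ≈[ n ] y: y lies in the basic open set of all sequences
-- whose first n entries are those of x.
infix 4 _≈[_]_
_≈[_]_ : 2^ω → ℕ → 2^ω → Set
x ≈[ n ] y = ∀ i → i < n → x i ≡ y i

Dense : Pred 2^ω 0ℓ → Set
Dense D = ∀ x n → ∃[ y ] D y × x ≈[ n ] y

-- The edge relation contains every point (x , y) of its closure in the
-- product 2^ω × 2^ω; the boxes of level n form a neighbourhood base there.
Closed : Graph Cantor → Set
Closed G = ∀ x y →
  (∀ n → ∃[ x′ ] ∃[ y′ ] x ≈[ n ] x′ × y ≈[ n ] y′ × x′ ~ y′) → x ~ y
  where open Graph G

{-# OPTIONS --safe #-}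

-- Coordinate i of a point x is a switch: if it is on, then x forbids itself
-- every neighbour in the clopen set Marked i, unless x lies in that set too.
-- Such a condition only concerns finite prefixes, so the graph is closed.  As
-- Marked i depends on the coordinates below i and misses the zero sequence,
-- the zero sequence is adjacent to everything, and a point whose first 1 is
-- at i is forbidden by no point whose ones are all below i.  The
-- vertices of the random graph are the binary expansions of the positive
-- integers.  Given A and B, let the binary digits of i list B (and one fresh
-- large number, making i large); then Marked i contains B and misses A, and
-- 2 ^ i is the required vertex.
--
-- An arbitrary countable graph lives on the singletons {n} ⊆ ℕ, which
-- accumulate only at ∅, and ∅ may be adjacent to everything.
module Submission where

open import Defs
open import Data.Bool.Base using (Bool; true; false; not)
open import Data.Bool.Properties using (not-involutive; ¬-not)
open import Data.List.Base using (_∷_; _++_)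
open import Data.List.Extrema.Nat using (max; xs≤max)
open import Data.List.Membership.DecPropositional using () renaming (_∈?_ to member?)
open import Data.List.Membership.Propositional using (_∈_; _∉_)
open import Data.List.Membership.Propositional.Properties using (∈-++⁺ˡ; ∈-++⁺ʳ)
import Data.List.Relation.Unary.All as All
open import Data.List.Relation.Unary.Any using (here; there)
open import Data.Nat.Base
  using (ℕ; zero; suc; pred; _+_; _^_; _⊔_; _≤_; _<_; z≤n; s≤s; ⌊_/2⌋; >-nonZero)
open import Data.Nat.Properties
open import Data.Product.Base using (Σ-syntax; ∃-syntax; _×_; _,_; proj₁; proj₂; swap)
open import Function.Base using (_∘_)
open import Function.Bundles using (Injection; Inverse; _⇔_; mk⇔; Equivalence)
import Function.Construct.Composition as Composition
import Function.Construct.Identity as Identity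
import Function.Construct.Symmetry as Symmetry
open import Level using (0ℓ)
open import Relation.Binary.Bundles using (Setoid)
open import Relation.Binary.PropositionalEquality
open import Relation.Nullary.Decidable using (yes; no; does; dec-true; dec-false)
open import Relation.Nullary.Negation using (¬_; contradiction)
open import Relation.Unary using (Pred)

-- Embeddings and induced subgraphs

private
  variable
    V W : Setoid 0ℓ 0ℓ

image : Injection V W → Pred (Setoid.Carrier W) 0ℓ
image {V} {W} e x = ∃[ v ] Setoid._≈_ W (Injection.to e v) x

-- A membership proof for `image e` carries a preimage, so the inverse map is a projection;
-- injectivity of `e` makes it respect equality.
≅-image : {H : Graph V} {G : Graph W} (e : Injection V W) →
          (∀ v w → Graph._~_ H v w ⇔ Graph._~_ G (Injection.to e v) (Injection.to e w)) →
          H ≅ induced G (image e)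
≅-image {V} {W} e adj = record
  { bijection = record
    { to        = λ v → to v , v , Setoid.refl W
    ; from      = proj₁ ∘ proj₂
    ; to-cong   = e-cong
    ; from-cong = λ { {_ , _ , p} {_ , _ , q} x≈y →
        e.injective (W.trans p (W.trans x≈y (W.sym q))) }
    ; inverse   =
        (λ { {_ , _ , p} y≈ → W.trans (e-cong y≈) p }) ,
        (λ { {_} {_ , _ , p} y≈ → e.injective (W.trans p y≈) })
    }
  ; adjacency = adj
  }
  where
  module V = Setoid V
  module W = Setoid W
  module e = Injection e
  open e using (to) renaming (cong to e-cong)

≅-sym : {H : Graph V} {G : Graph W} → H ≅ G → G ≅ H
≅-sym {V} {W} {H} {G} φ = record
  { bijection = Symmetry.inverse bijection
  ; adjacency = λ x y → mk⇔
      (λ x~y → Equivalence.from (adjacency (from x) (from y))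
        (proj₁ G.~-resp (W.sym (strictlyInverseˡ y))
          (proj₂ G.~-resp (W.sym (strictlyInverseˡ x)) x~y)))
      (λ x~y → proj₁ G.~-resp (strictlyInverseˡ y)
        (proj₂ G.~-resp (strictlyInverseˡ x)
          (Equivalence.to (adjacency (from x) (from y)) x~y)))
  }
  where
  open _≅_ φ using (bijection; adjacency)
  open Inverse bijection using (from; strictlyInverseˡ)
  module W = Setoid W
  module G = Graph G

-- Binary expansions, least significant digit first

odd : ℕ → Bool
odd zero    = false
odd (suc n) = not (odd n)

bit : ℕ → 2^ω
bit n zero    = odd n
bit n (suc j) = bit ⌊ n /2⌋ j

digit : Bool → ℕ → ℕ
digit false n = n + n
digit true  n = suc (n + n)

enc : 2^ω → ℕ → ℕ
enc x zero    = 0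
enc x (suc k) = digit (x 0) (enc (x ∘ suc) k)

odd-double : ∀ n → odd (n + n) ≡ false
odd-double zero = refl
odd-double (suc n) rewrite +-suc n n | odd-double n = refl

odd-digit : ∀ b n → odd (digit b n) ≡ b
odd-digit false n = odd-double n
odd-digit true  n = cong not (odd-double n)

half-digit : ∀ b n → ⌊ digit b n /2⌋ ≡ n
half-digit false n = sym (n≡⌊n+n/2⌋ n)
half-digit true  n = sym (n≡⌈n+n/2⌉ n)

digit-suc : ∀ b n → digit b (suc n) ≡ suc (suc (digit b n))
digit-suc false n = cong suc (+-suc n n)
digit-suc true  n = cong (suc ∘ suc) (+-suc n n)

digit-odd-half : ∀ n → digit (odd n) ⌊ n /2⌋ ≡ n
digit-odd-half zero    = refl
digit-odd-half (suc zero) = refl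
digit-odd-half (suc (suc n))
  rewrite not-involutive (odd n) | digit-suc (odd n) ⌊ n /2⌋ =
  cong (suc ∘ suc) (digit-odd-half n)

half-≤ : ∀ {n k} → n ≤ suc k → ⌊ n /2⌋ ≤ k
half-≤ {zero}  _ = z≤n
half-≤ {suc n} (s≤s n≤k) = ≤-trans (≤-pred (⌊n/2⌋<n n)) n≤k

bit-enc : ∀ x {j k} → j < k → bit (enc x k) j ≡ x j
bit-enc x {zero}  {suc k} _         = odd-digit (x 0) _
bit-enc x {suc j} {suc k} (s≤s j<k) =
  trans (cong (λ n → bit n j) (half-digit (x 0) _)) (bit-enc (x ∘ suc) j<k)

-- Removing a digit halves `n`, which lowers a positive `n` by at least one, so `k` digits recover
-- every `n ≤ k`.
enc-bit : ∀ {n k} → n ≤ k → enc (bit n) k ≡ n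
enc-bit {_} {zero}  z≤n = refl
enc-bit {n} {suc k} n≤k =
  trans (cong (digit (odd n)) (enc-bit (half-≤ n≤k))) (digit-odd-half n)

enc-cong : ∀ {x y} k → x ≈[ k ] y → enc x k ≡ enc y k
enc-cong zero    _   = refl
enc-cong (suc k) x≈y =
  cong₂ digit (x≈y 0 (s≤s z≤n)) (enc-cong k λ i i<k → x≈y (suc i) (s≤s i<k))

bit-≥ : ∀ {n} j → n ≤ j → bit n j ≡ false
bit-≥ zero    z≤n = refl
bit-≥ (suc j) n≤j = bit-≥ j (half-≤ n≤j)

bit⇒< : ∀ n j → bit n j ≡ true → j < n
bit⇒< n j eq = ≰⇒> λ n≤j → contradiction (trans (sym eq) (bit-≥ j n≤j)) λ ()

bit-injective : ∀ {m n} → bit m ≗ bit n → m ≡ n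
bit-injective {m} {n} eq = begin
  m                   ≡⟨ enc-bit (m≤m⊔n m n) ⟨
  enc (bit m) (m ⊔ n) ≡⟨ enc-cong (m ⊔ n) (λ i _ → eq i) ⟩
  enc (bit n) (m ⊔ n) ≡⟨ enc-bit (m≤n⊔m m n) ⟩
  n                   ∎
  where open ≡-Reasoning

half-2^ : ∀ i → ⌊ 2 ^ suc i /2⌋ ≡ 2 ^ i
half-2^ i rewrite +-identityʳ (2 ^ i) = half-digit false (2 ^ i)

bit-2^ : ∀ i → bit (2 ^ i) i ≡ true
bit-2^ zero    = refl
bit-2^ (suc i) = trans (cong (λ n → bit n i) (half-2^ i)) (bit-2^ i)

bit-2^⇒≡ : ∀ i j → bit (2 ^ i) j ≡ true → j ≡ i
bit-2^⇒≡ zero    j       eq = n<1⇒n≡0 (bit⇒< 1 j eq)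
bit-2^⇒≡ (suc i) zero    eq rewrite +-identityʳ (2 ^ i) | odd-double (2 ^ i) =
  contradiction eq λ ()
bit-2^⇒≡ (suc i) (suc j) eq =
  cong suc (bit-2^⇒≡ i j (trans (cong (λ n → bit n j) (sym (half-2^ i))) eq))

-- The closed graph

-- Vertex m is the expansion of m + 1, so that no vertex is the zero sequence,
-- which no Marked i may contain.
Marked : ℕ → 2^ω → Set
Marked i x = ∃[ m ] enc x i ≡ suc m × bit i m ≡ true

Marked-cong : ∀ i {x y} → x ≈[ i ] y → Marked i x → Marked i y
Marked-cong i x≈y (m , eq , b) = m , trans (sym (enc-cong i x≈y)) eq , b

-- A zero prefix encodes 0, whereas `Marked` asks for a successor.
¬Marked-zero : ∀ i {x} → (∀ j → j < i → x j ≡ false) → ¬ Marked i x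
¬Marked-zero i x≈0 (m , eq , _) = contradiction
  (trans (sym eq) (trans (enc-cong i x≈bit0) (enc-bit {k = i} z≤n))) λ ()
  where
  x≈bit0 : _ ≈[ i ] bit 0
  x≈bit0 j j<i = trans (x≈0 j j<i) (sym (bit-≥ j z≤n))

infix 4 _⊴_
_⊴_ : 2^ω → 2^ω → Set
x ⊴ y = ∀ i → x i ≡ true → Marked i y → Marked i x

-- The condition at `i` reads only `x i` and the first `i` entries of both points, so a single
-- approximation to level `suc i` settles it.
⊴-closed : ∀ x y →
  (∀ n → ∃[ x′ ] ∃[ y′ ] x ≈[ n ] x′ × y ≈[ n ] y′ × x′ ⊴ y′) → x ⊴ y
⊴-closed x y approx i xi my =
  let x′ , y′ , x≈x′ , y≈y′ , x′⊴y′ = approx (suc i)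
  in Marked-cong i (λ j j<i → sym (x≈x′ j (m<n⇒m<1+n j<i)))
       (x′⊴y′ i (trans (sym (x≈x′ i ≤-refl)) xi)
         (Marked-cong i (λ j j<i → y≈y′ j (m<n⇒m<1+n j<i)) my))

-- Pointwise equal points agree to every level, so a constant approximation can be fed to
-- `⊴-closed`.
⊴-resp : ∀ {x x′ y y′} → x ≗ x′ → y ≗ y′ → x ⊴ y → x′ ⊴ y′
⊴-resp x≈x′ y≈y′ x⊴y =
  ⊴-closed _ _ λ _ → _ , _ , (λ j _ → sym (x≈x′ j)) , (λ j _ → sym (y≈y′ j)) , x⊴y

switchGraph : Graph Cantor
switchGraph = record
  { _~_    = λ x y → x ⊴ y × y ⊴ x
  ; ~-resp =
      (λ y≈y′ (p , q) → ⊴-resp (λ _ → refl) y≈y′ p , ⊴-resp y≈y′ (λ _ → refl) q) ,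
      (λ x≈x′ (p , q) → ⊴-resp x≈x′ (λ _ → refl) p , ⊴-resp (λ _ → refl) x≈x′ q)
  ; ~-refl = (λ _ _ m → m) , (λ _ _ m → m)
  ; ~-sym  = swap
  }

switchGraph-closed : Closed switchGraph
switchGraph-closed x y approx =
  ⊴-closed x y (λ n → let x′ , y′ , p , q , e , _ = approx n in x′ , y′ , p , q , e) ,
  ⊴-closed y x (λ n → let x′ , y′ , p , q , _ , e = approx n in y′ , x′ , q , p , e)

switchGraph-zero : ∀ x → Graph._~_ switchGraph x (λ _ → false)
switchGraph-zero x =
  (λ i _ m → contradiction m (¬Marked-zero i (λ _ _ → refl))) , (λ _ ())

-- An isolated point would equal its neighbour zero, and then also the constant `true` sequence,
-- which is adjacent to zero.
switchGraph-withoutIsolated : WithoutIsolatedVertices switchGraph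
switchGraph-withoutIsolated x isolated =
  contradiction (trans (sym (x≈0 0)) (isolated (λ _ → true) x~1 0)) λ ()
  where
  open Graph switchGraph
  x≈0 : ∀ j → x j ≡ false
  x≈0 = isolated (λ _ → false) (switchGraph-zero x)
  x~1 : x ~ (λ _ → true)
  x~1 = proj₂ ~-resp (λ j → sym (x≈0 j)) (~-sym (switchGraph-zero _))

-- The dense random subgraph

point : Injection (setoid ℕ) Cantor
point = record
  { to        = λ n → bit (suc n)
  ; cong      = λ { refl _ → refl }
  ; injective = λ eq → suc-injective (bit-injective eq)
  }

pullback : Injection V W → Graph W → Graph V
pullback e G = record
  { _~_    = λ v w → to v ~ to w
  ; ~-resp = (λ p → proj₁ ~-resp (e-cong p)) , (λ p → proj₂ ~-resp (e-cong p))
  ; ~-refl = ~-refl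
  ; ~-sym  = ~-sym
  }
  where
  open Graph G
  open Injection e using (to) renaming (cong to e-cong)

randomGraph : Graph (setoid ℕ)
randomGraph = pullback point switchGraph

randomGraph-extension : ExtensionProperty randomGraph
randomGraph-extension A B disjoint = v , v∉A , v∉B , All.tabulate v~a , All.tabulate v≁b
  where
  h : ℕ
  h = suc (max 0 (A ++ B))

  <h : ∀ {a} → a ∈ A ++ B → a < h
  <h a∈ = s≤s (All.lookup (xs≤max 0 (A ++ B)) a∈)

  χ : 2^ω
  χ j = does (member? _≟_ j (h ∷ B))

  -- Digits 0 to `h` are read: the elements of `B` lie below `h`, and the digit at `h` itself forces
  -- `h < i`.
  i : ℕ
  i = enc χ (suc h)

  bit-i : ∀ {j} → j ≤ h → bit i j ≡ χ j
  bit-i j≤h = bit-enc χ (s≤s j≤h)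

  h<i : h < i
  h<i = bit⇒< i h (trans (bit-i ≤-refl) (dec-true (member? _≟_ h (h ∷ B)) (here refl)))

  -- Vertex `v` has the expansion of `suc v`, hence the predecessor of `2 ^ i`.
  v : ℕ
  v = pred (2 ^ i)

  1+v≡2^i : suc v ≡ 2 ^ i
  1+v≡2^i = suc-pred (2 ^ i) {{m^n≢0 2 i}}

  v-bit : bit (suc v) i ≡ true
  v-bit rewrite 1+v≡2^i = bit-2^ i

  v-bit⇒≡ : ∀ j → bit (suc v) j ≡ true → j ≡ i
  v-bit⇒≡ j rewrite 1+v≡2^i = bit-2^⇒≡ i j

  ¬Marked-v : ∀ j → j ≤ i → ¬ Marked j (bit (suc v))
  ¬Marked-v j j≤i = ¬Marked-zero j λ k k<j →
    ¬-not λ eq → <⇒≢ (<-≤-trans k<j j≤i) (v-bit⇒≡ k eq)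

  -- The elements of `A` and `B` are below `h < i`, while the digit of `suc v` at `i` gives `i ≤ v`.
  ∉A++B : v ∉ A ++ B
  ∉A++B v∈ = <-irrefl refl
    (<-≤-trans (<-trans (<h v∈) h<i) (≤-pred (bit⇒< (suc v) i v-bit)))

  v∉A : v ∉ A
  v∉A = ∉A++B ∘ ∈-++⁺ˡ

  v∉B : v ∉ B
  v∉B = ∉A++B ∘ ∈-++⁺ʳ A

  -- As `suc a ≤ i`, the first `i` digits determine the vertex `a`.
  enc-point : ∀ {a} → a ∈ A ++ B → enc (bit (suc a)) i ≡ suc a
  enc-point a∈ = enc-bit (<-trans (<h a∈) h<i)

  a∉h∷B : ∀ {a} → a ∈ A → a ∉ h ∷ B
  a∉h∷B a∈A (here a≡h)  = <⇒≢ (<h (∈-++⁺ˡ a∈A)) a≡h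
  a∉h∷B a∈A (there a∈B) = disjoint (a∈A , a∈B)

  ¬Marked-a : ∀ {a} → a ∈ A → ¬ Marked i (bit (suc a))
  ¬Marked-a {a} a∈A (m , eq , b)
    with refl ← suc-injective (trans (sym (enc-point (∈-++⁺ˡ a∈A))) eq) =
    contradiction (trans (sym b) (trans (bit-i (<⇒≤ (<h (∈-++⁺ˡ a∈A))))
      (dec-false (member? _≟_ a (h ∷ B)) (a∉h∷B a∈A)))) λ ()

  Marked-b : ∀ {b} → b ∈ B → Marked i (bit (suc b))
  Marked-b {b} b∈B = b , enc-point (∈-++⁺ʳ A b∈B) ,
    trans (bit-i (<⇒≤ (<h (∈-++⁺ʳ A b∈B))))
      (dec-true (member? _≟_ b (h ∷ B)) (there b∈B))

  v~a : ∀ {a} → a ∈ A → Graph._~_ randomGraph v a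
  -- The switches of `a` are at positions `j ≤ a < i`, and no such `Marked j` contains the point of
  -- `v`.
  v~a {a} a∈A = v⊴a , λ j aj marked → contradiction marked
    (¬Marked-v j (<⇒≤ (≤-<-trans (≤-pred (bit⇒< (suc a) j aj))
      (<-trans (<h (∈-++⁺ˡ a∈A)) h<i))))
    where
    v⊴a : bit (suc v) ⊴ bit (suc a)
    v⊴a j vj marked with refl ← v-bit⇒≡ j vj = contradiction marked (¬Marked-a a∈A)

  v≁b : ∀ {b} → b ∈ B → ¬ Graph._~_ randomGraph v b
  v≁b b∈B (v⊴b , _) = ¬Marked-v i ≤-refl (v⊴b i v-bit (Marked-b b∈B))

-- The first `n` entries of `x` followed by a 1 are read as a number, whose expansion is the nearby
-- vertex.
image-point-dense : Dense (image point)
image-point-dense x n = bit (suc m) , (m , λ _ → refl) , λ i i<n → begin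
  x i            ≡⟨ z-< i<n ⟨
  z i            ≡⟨ bit-enc z (m<n⇒m<1+n i<n) ⟨
  bit N i        ≡⟨ cong (λ k → bit k i) 1+m≡N ⟨
  bit (suc m) i  ∎
  where
  open ≡-Reasoning

  -- The final 1 makes the encoded number positive.
  z : 2^ω
  z i with i <? n
  ... | yes _ = x i
  ... | no  _ = true

  z-< : ∀ {i} → i < n → z i ≡ x i
  z-< {i} i<n with i <? n
  ... | yes _   = refl
  ... | no  i≮n = contradiction i<n i≮n

  z-n : z n ≡ true
  z-n with n <? n
  ... | yes n<n = contradiction n<n (<-irrefl refl)
  ... | no  _   = refl

  N m : ℕ
  N = enc z (suc n)
  m = pred N

  1+m≡N : suc m ≡ N
  1+m≡N = suc-pred N {{>-nonZero (≤-<-trans z≤n (bit⇒< N n (trans (bit-enc z ≤-refl) z-n)))}}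

-- Arbitrary countable graphs

singleton : ℕ → 2^ω
singleton n i = does (n ≟ i)

singleton-true : ∀ n → singleton n n ≡ true
singleton-true n = dec-true (n ≟ n) refl

singleton-true⇒≡ : ∀ n i → singleton n i ≡ true → n ≡ i
singleton-true⇒≡ n i eq with n ≟ i
... | yes n≡i = n≡i
... | no  n≢i = contradiction (trans (sym eq) (dec-false (n ≟ i) n≢i)) λ ()

singletonInjection : Injection (setoid ℕ) Cantor
singletonInjection = record
  { to        = singleton
  ; cong      = λ { refl _ → refl }
  ; injective = λ {m} {n} eq → singleton-true⇒≡ m n (trans (eq n) (singleton-true n))
  }

module _ {V : Setoid 0ℓ 0ℓ} (H : Graph V) (f : Injection V (setoid ℕ)) where
  open Graph H
  open Injection f using (to; injective) renaming (cong to f-cong)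

  singletonEmbedding : Injection V Cantor
  singletonEmbedding = Composition.injection f singletonInjection

  Linked : ℕ → ℕ → Set
  Linked m n = ∃[ v ] ∃[ w ] to v ≡ m × to w ≡ n × v ~ w

  Linked⇒~ : ∀ {v w} → Linked (to v) (to w) → v ~ w
  Linked⇒~ (_ , _ , p , q , e) =
    proj₁ ~-resp (injective q) (proj₂ ~-resp (injective p) e)

  -- The coordinate k where x and y differ serves only to make this reflexive.
  infix 4 _≈∨Linked_
  _≈∨Linked_ : 2^ω → 2^ω → Set
  x ≈∨Linked y = ∀ k → x k ≢ y k → ∀ m n → x m ≡ true → y n ≡ true → Linked m n

  -- Each instance reads only the coordinates `k`, `m` and `n`, so one level beyond all three
  -- suffices.
  ≈∨Linked-closed : ∀ x y →
    (∀ n → ∃[ x′ ] ∃[ y′ ] x ≈[ n ] x′ × y ≈[ n ] y′ × x′ ≈∨Linked y′) → x ≈∨Linked y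
  ≈∨Linked-closed x y approx k xk≢yk m n xm yn =
    let x′ , y′ , x≈x′ , y≈y′ , e = approx (suc (k ⊔ (m ⊔ n)))
        k< = s≤s (m≤m⊔n k (m ⊔ n))
        m< = s≤s (≤-trans (m≤m⊔n m n) (m≤n⊔m k (m ⊔ n)))
        n< = s≤s (≤-trans (m≤n⊔m m n) (m≤n⊔m k (m ⊔ n)))
    in e k (λ eq → xk≢yk (trans (x≈x′ k k<) (trans eq (sym (y≈y′ k k<)))))
         m n (trans (sym (x≈x′ m m<)) xm) (trans (sym (y≈y′ n n<)) yn)

  ≈∨Linked-resp : ∀ {x x′ y y′} → x ≗ x′ → y ≗ y′ → x ≈∨Linked y → x′ ≈∨Linked y′
  ≈∨Linked-resp x≈x′ y≈y′ e =
    ≈∨Linked-closed _ _ λ _ → _ , _ , (λ j _ → sym (x≈x′ j)) , (λ j _ → sym (y≈y′ j)) , e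

  singletonGraph : Graph Cantor
  singletonGraph = record
    { _~_    = _≈∨Linked_
    ; ~-resp = (λ y≈y′ → ≈∨Linked-resp (λ _ → refl) y≈y′) ,
               (λ x≈x′ → ≈∨Linked-resp x≈x′ (λ _ → refl))
    ; ~-refl = λ _ x≢x → contradiction refl x≢x
    ; ~-sym  = λ e k y≢x m n ym xn →
        let v , w , p , q , v~w = e k (y≢x ∘ sym) n m xn ym
        in w , v , q , p , ~-sym v~w
    }

  singleton-adjacency : ∀ v w → v ~ w ⇔ singleton (to v) ≈∨Linked singleton (to w)
  singleton-adjacency v w = mk⇔ ⇒ ⇐
    where
    ⇒ : v ~ w → singleton (to v) ≈∨Linked singleton (to w)
    ⇒ v~w _ _ m n vm wn =
      v , w , singleton-true⇒≡ (to v) m vm , singleton-true⇒≡ (to w) n wn , v~w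

    ⇐ : singleton (to v) ≈∨Linked singleton (to w) → v ~ w
    ⇐ e with to w ≟ to v
    -- With equal codes the condition on the singletons is vacuous, and the edge is the loop at
    -- `v ≈ w`; otherwise the singletons differ at `to v`.
    ... | yes fw≡fv = proj₁ ~-resp (injective (sym fw≡fv)) ~-refl
    ... | no  fw≢fv = Linked⇒~ (e (to v) differ (to v) (to w)
                        (singleton-true (to v)) (singleton-true (to w)))
      where
      differ : singleton (to v) (to v) ≢ singleton (to w) (to v)
      differ eq =
        fw≢fv (singleton-true⇒≡ (to w) (to v) (trans (sym eq) (singleton-true (to v))))

  embedsInto-singletonGraph : EmbedsInto H singletonGraph
  embedsInto-singletonGraph =
    image singletonEmbedding , ≅-image singletonEmbedding singleton-adjacency

theorem7p4 : (Σ[ G ∈ Graph Cantor ]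
    Closed G
    × WithoutIsolatedVertices G
    × (Σ[ D ∈ Pred 2^ω 0ℓ ]
    Dense D
    × (Σ[ V ∈ Setoid 0ℓ 0ℓ ] Σ[ R ∈ Graph V ]
    IsRandomGraph R × induced G D ≅ R)))
    × (∀ (V : Setoid 0ℓ 0ℓ) (H : Graph V) → Countable V →
    Σ[ G ∈ Graph Cantor ] Closed G × EmbedsInto H G)
theorem7p4 =
  ( switchGraph , switchGraph-closed , switchGraph-withoutIsolated
  , image point , image-point-dense
  , setoid ℕ , randomGraph
  , (Identity.injection (setoid ℕ) , randomGraph-extension)
  , ≅-sym {G = induced switchGraph (image point)}
      (≅-image {H = randomGraph} {G = switchGraph} point λ _ _ → Identity.⇔-id _)) ,
  λ V H f → singletonGraph H f , ≈∨Linked-closed H f , embedsInto-singletonGraph H f
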